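{- Let $(A,G,x,+,[\ ])$ be a genoid and let $P$ be a right act of $G$. For every right act $T$ of $G$, the map $$\Lambda:\hom(T\times A,P)\to\hom(T,P^A),\qquad (\Lambda f)(t)=f(t+,x)\quad (t\in T),$$ is a bijection, whose inverse is the map $$\Lambda':\hom(T,P^A)\to\hom(T\times A,P),\qquad (\Lambda' g)(t,a)=ev(g(t),a)\quad (t\in T,\ a\in A).$$ Consequently $(P^A,ev)$ is the exponential object of $P$ by $A$ in the (cartesian closed) category $Act_G$ of right acts of $G$. In particular, taking $T=P=A$, there is a canonical bijection $\Lambda:\hom(A\times A,A)\to\hom(A,A^A)$.
   Context: A genoid $(A,G,x,+,[\ ])$ consists of a monoid $(G,e)$ with unit $e$, a right act $A$ of $G$ (a set with an associative, unital right action of $G$), an element $x\in A$, an element $+\in G$, and a map $[\ ]:A\times G\to G$, $(a,u)\mapsto[a,u]$, such that for all $a\in A$ and $u\in G$: (G1) $x[a,u]=a$; (G2) $+[a,u]=u$; (G3) $u=[xu,+u]$. Products in $G$ and the action of $G$ are written by juxtaposition; thus $t+$ denotes the action of the element $+\in G$ on $t$, and $u+$ denotes the product of $u$ and $+$ in $G$. $Act_G$ is the category of right acts of $G$ and $G$-equivariant maps (homomorphisms), $\hom$ denotes its hom-sets, and products of acts are cartesian products with componentwise action. For a right act $P$ of $G$, $P^A=(P,\circ)$ is the right act of $G$ with the same underlying set as $P$ and with action $p\circ u=p[x,u+]$ for $p\in P$, $u\in G$. The map $ev:P^A\times A\to P$ is defined by $ev(p,a)=p[a,e]$ for $p\in P$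 and $a\in A$. -}

module Defs where

open import Level using (Level; _⊔_; suc)
open import Algebra.Bundles using (Monoid)
open import Data.Product using (_×_; _,_; proj₁; proj₂; ∃!)
open import Data.Product.Relation.Binary.Pointwise.NonDependent using (×-setoid)
open import Function.Structures using (IsBijection; IsInverse)
open import Relation.Binary.Bundles using (Setoid)
open import Relation.Binary.Core using (Rel; _Preserves_⟶_)
open import Relation.Binary.Structures using (IsEquivalence)
import Algebra.Module.Definitions.Right as RightDefs
import Relation.Binary.Reasoning.Setoid as SetoidReasoning

record Category (o h e : Level) : Set (suc (o ⊔ h ⊔ e)) where
  infix  4 _⇒_ _≈_
  infixr 9 _∘_
  field
    Obj       : Set o
    _⇒_       : Obj → Obj → Set h
    _≈_       : ∀ {X Y} → Rel (X ⇒ Y) e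
    id        : ∀ {X} → X ⇒ X
    _∘_       : ∀ {X Y Z} → Y ⇒ Z → X ⇒ Y → X ⇒ Z
    isEquiv   : ∀ {X Y} → IsEquivalence (_≈_ {X} {Y})
    ∘-cong    : ∀ {X Y Z} {f f′ : Y ⇒ Z} {g g′ : X ⇒ Y} →
                f ≈ f′ → g ≈ g′ → f ∘ g ≈ f′ ∘ g′
    assoc     : ∀ {W X Y Z} (f : Y ⇒ Z) (g : X ⇒ Y) (h : W ⇒ X) →
                (f ∘ g) ∘ h ≈ f ∘ (g ∘ h)
    identityˡ : ∀ {X Y} (f : X ⇒ Y) → id ∘ f ≈ f
    identityʳ : ∀ {X Y} (f : X ⇒ Y) → f ∘ id ≈ f

module _ {o h e : Level} (C : Category o h e) where
  open Category C

  record Terminal : Set (o ⊔ h ⊔ e) where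
    field
      ⊤        : Obj
      !        : ∀ {X} → X ⇒ ⊤
      !-unique : ∀ {X} (f : X ⇒ ⊤) → f ≈ !

  record BinaryProducts : Set (o ⊔ h ⊔ e) where
    infixr 7 _⊗_
    field
      _⊗_      : Obj → Obj → Obj
      π₁       : ∀ {X Y} → X ⊗ Y ⇒ X
      π₂       : ∀ {X Y} → X ⊗ Y ⇒ Y
      ⟨_,_⟩    : ∀ {T X Y} → T ⇒ X → T ⇒ Y → T ⇒ X ⊗ Y
      project₁ : ∀ {T X Y} (f : T ⇒ X) (g : T ⇒ Y) → π₁ ∘ ⟨ f , g ⟩ ≈ f
      project₂ : ∀ {T X Y} (f : T ⇒ X) (g : T ⇒ Y) → π₂ ∘ ⟨ f , g ⟩ ≈ g
      unique   : ∀ {T X Y} (f : T ⇒ X) (g : T ⇒ Y) (k : T ⇒ X ⊗ Y) →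
                 π₁ ∘ k ≈ f → π₂ ∘ k ≈ g → k ≈ ⟨ f , g ⟩

  module _ (products : BinaryProducts) where
    open BinaryProducts products

    IsExponential : (B A E : Obj) → E ⊗ A ⇒ B → Set (o ⊔ h ⊔ e)
    IsExponential B A E ev =
      ∀ (T : Obj) (f : T ⊗ A ⇒ B) →
      ∃! _≈_ (λ (g : T ⇒ E) → ev ∘ ⟨ g ∘ π₁ , π₂ ⟩ ≈ f)

    record Exponential (B A : Obj) : Set (o ⊔ h ⊔ e) where
      field
        object        : Obj
        ev            : object ⊗ A ⇒ B
        isExponential : IsExponential B A object ev

  record CartesianClosed : Set (o ⊔ h ⊔ e) where
    field
      terminal     : Terminal
      products     : BinaryProducts
      exponentials : ∀ B A → Exponential products B A

-- Sets are setoids throughout: maps are required to respect the equalities,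
-- and homomorphisms are compared pointwise.  One level ℓ plays the role of the
-- fixed universe of sets, so that the acts form a cartesian closed category.

module _ {ℓ : Level} (G : Monoid ℓ ℓ) where
  private module G = Monoid G

  record RightAct : Set (suc ℓ) where
    infixl 7 _·_
    field
      setoid : Setoid ℓ ℓ
    open Setoid setoid public
    open RightDefs G.Carrier _≈_
    field
      _·_        : Carrier → G.Carrier → Carrier
      ·-cong     : Congruent G._≈_ _·_
      ·-assoc    : Associative G._∙_ _·_
      ·-identity : RightIdentity G.ε _·_

module _ {ℓ : Level} {G : Monoid ℓ ℓ} where
  private module G = Monoid G

  record IsHomomorphism (S T : RightAct G)
    (f : RightAct.Carrier S → RightAct.Carrier T) : Set ℓ where
    private
      module S = RightAct S
      module T = RightAct T
    field
      cong        : f Preserves S._≈_ ⟶ T._≈_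
      equivariant : ∀ s u → f (s S.· u) T.≈ f s T.· u

  record Hom (S T : RightAct G) : Set ℓ where
    constructor mkHom
    field
      ⟦_⟧            : RightAct.Carrier S → RightAct.Carrier T
      isHomomorphism : IsHomomorphism S T ⟦_⟧
    open IsHomomorphism isHomomorphism public

  infix 4 _≈ₕ_
  _≈ₕ_ : {S T : RightAct G} → Rel (Hom S T) ℓ
  _≈ₕ_ {T = T} f g = ∀ s → RightAct._≈_ T (Hom.⟦_⟧ f s) (Hom.⟦_⟧ g s)

  infixr 7 _×ₐ_
  _×ₐ_ : RightAct G → RightAct G → RightAct G
  S ×ₐ T = record
    { setoid     = ×-setoid S.setoid T.setoid
    ; _·_        = λ (s , t) u → s S.· u , t T.· u
    ; ·-cong     = λ (p , q) r → S.·-cong p r , T.·-cong q r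
    ; ·-assoc    = λ (s , t) u v → S.·-assoc s u v , T.·-assoc t u v
    ; ·-identity = λ (s , t) → S.·-identity s , T.·-identity t
    }
    where
    module S = RightAct S
    module T = RightAct T

Act : ∀ {ℓ} → Monoid ℓ ℓ → Category (suc ℓ) ℓ ℓ
Act G = record
  { Obj       = RightAct G
  ; _⇒_       = Hom
  ; _≈_       = _≈ₕ_
  ; id        = λ {X} → mkHom (λ s → s) record
      { cong = λ p → p ; equivariant = λ _ _ → RightAct.refl X }
  ; _∘_       = λ {_} {_} {Z} f g → mkHom (λ s → Hom.⟦_⟧ f (Hom.⟦_⟧ g s)) record
      { cong        = λ p → Hom.cong f (Hom.cong g p)
      ; equivariant = λ s u → RightAct.trans Z
          (Hom.cong f (Hom.equivariant g s u))
          (Hom.equivariant f (Hom.⟦_⟧ g s) u)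
      }
  ; isEquiv   = λ {_} {Y} → record
      { refl  = λ _ → RightAct.refl Y
      ; sym   = λ p s → RightAct.sym Y (p s)
      ; trans = λ p q s → RightAct.trans Y (p s) (q s)
      }
  ; ∘-cong    = λ {_} {_} {Z} {f} {_} {_} {g′} p q s →
      RightAct.trans Z (Hom.cong f (q s)) (p (Hom.⟦_⟧ g′ s))
  ; assoc     = λ {_} {_} {_} {Z} _ _ _ _ → RightAct.refl Z
  ; identityˡ = λ {_} {Y} _ _ → RightAct.refl Y
  ; identityʳ = λ {_} {Y} _ _ → RightAct.refl Y
  }

actProducts : ∀ {ℓ} (G : Monoid ℓ ℓ) → BinaryProducts (Act G)
actProducts G = record
  { _⊗_      = _×ₐ_
  ; π₁       = λ {X} → mkHom proj₁ record
      { cong = proj₁ ; equivariant = λ _ _ → RightAct.refl X }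
  ; π₂       = λ {_} {Y} → mkHom proj₂ record
      { cong = proj₂ ; equivariant = λ _ _ → RightAct.refl Y }
  ; ⟨_,_⟩    = λ f g → mkHom (λ t → Hom.⟦_⟧ f t , Hom.⟦_⟧ g t) record
      { cong        = λ p → Hom.cong f p , Hom.cong g p
      ; equivariant = λ t u → Hom.equivariant f t u , Hom.equivariant g t u
      }
  ; project₁ = λ {_} {X} _ _ _ → RightAct.refl X
  ; project₂ = λ {_} {_} {Y} _ _ _ → RightAct.refl Y
  ; unique   = λ _ _ _ p q t → p t , q t
  }

record Genoid (ℓ : Level) : Set (suc ℓ) where
  field
    monoid : Monoid ℓ ℓ
    act    : RightAct monoid
  private
    module G = Monoid monoid
    module A = RightAct act
  field
    x       : A.Carrier
    +       : G.Carrier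
    [_,_]   : A.Carrier → G.Carrier → G.Carrier
    []-cong : ∀ {a b u v} → a A.≈ b → u G.≈ v → [ a , u ] G.≈ [ b , v ]
    G1      : ∀ a u → x A.· [ a , u ] A.≈ a
    G2      : ∀ a u → + G.∙ [ a , u ] G.≈ u
    G3      : ∀ u → u G.≈ [ x A.· u , + G.∙ u ]

module _ {ℓ : Level} (𝔾 : Genoid ℓ) where
  open Genoid 𝔾
  private
    module G = Monoid monoid
    module A = RightAct act

  []-∙ : ∀ a u v → [ a , u ] G.∙ v G.≈ [ a A.· v , u G.∙ v ]
  []-∙ a u v = G.trans (G3 _) ([]-cong
    (A.trans (A.sym (A.·-assoc _ _ _)) (A.·-cong (G1 a u) G.refl))
    (G.trans (G.sym (G.assoc _ _ _)) (G.∙-cong (G2 a u) G.refl)))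

  infix 8 _^A
  _^A : RightAct monoid → RightAct monoid
  P ^A = record
    { setoid     = P.setoid
    ; _·_        = λ p u → p P.· [ x , u G.∙ + ]
    ; ·-cong     = λ p≈q u≈v →
        P.·-cong p≈q ([]-cong A.refl (G.∙-cong u≈v G.refl))
    ; ·-assoc    = λ p u v →
        P.trans (P.·-assoc p _ _) (P.·-cong P.refl (∘-assoc u v))
    ; ·-identity = λ p →
        P.trans (P.·-cong P.refl ∘-identity) (P.·-identity p)
    }
    where
    module P = RightAct P

    ∘-assoc : ∀ u v → [ x , u G.∙ + ] G.∙ [ x , v G.∙ + ] G.≈
                      [ x , (u G.∙ v) G.∙ + ]
    ∘-assoc u v = begin
      [ x , u G.∙ + ] G.∙ [ x , v G.∙ + ]
        ≈⟨ []-∙ _ _ _ ⟩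
      [ x A.· [ x , v G.∙ + ] , (u G.∙ +) G.∙ [ x , v G.∙ + ] ]
        ≈⟨ []-cong (G1 _ _)
             (G.trans (G.assoc _ _ _) (G.∙-cong G.refl (G2 _ _))) ⟩
      [ x , u G.∙ (v G.∙ +) ]
        ≈⟨ []-cong A.refl (G.sym (G.assoc _ _ _)) ⟩
      [ x , (u G.∙ v) G.∙ + ] ∎
      where open SetoidReasoning G.setoid

    ∘-identity : [ x , G.ε G.∙ + ] G.≈ G.ε
    ∘-identity = G.sym (G.trans (G3 G.ε) ([]-cong (A.·-identity x)
      (G.trans (G.identityʳ +) (G.sym (G.identityˡ +)))))

  module _ (P : RightAct monoid) where
    private module P = RightAct P

    evMap : RightAct.Carrier (P ^A ×ₐ act) → P.Carrier
    evMap (p , a) = p P.· [ a , G.ε ]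

    module _ (T : RightAct monoid) where
      private module T = RightAct T

      ΛMap : Hom (T ×ₐ act) P → T.Carrier → RightAct.Carrier (P ^A)
      ΛMap f t = Hom.⟦_⟧ f (t T.· + , x)

      Λ′Map : Hom T (P ^A) → RightAct.Carrier (T ×ₐ act) → P.Carrier
      Λ′Map g (t , a) = evMap (Hom.⟦_⟧ g t , a)

      record ΛIsBijectionWithInverseΛ′ : Set ℓ where
        field
          Λ-isHomomorphism  : ∀ f → IsHomomorphism T (P ^A) (ΛMap f)
          Λ′-isHomomorphism : ∀ g → IsHomomorphism (T ×ₐ act) P (Λ′Map g)

        Λ : Hom (T ×ₐ act) P → Hom T (P ^A)
        Λ f = mkHom (ΛMap f) (Λ-isHomomorphism f)

        Λ′ : Hom T (P ^A) → Hom (T ×ₐ act) P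
        Λ′ g = mkHom (Λ′Map g) (Λ′-isHomomorphism g)

        field
          isBijection : IsBijection _≈ₕ_ _≈ₕ_ Λ
          isInverse   : IsInverse _≈ₕ_ _≈ₕ_ Λ Λ′

    record EvIsExponential : Set (suc ℓ) where
      field
        ev-isHomomorphism : IsHomomorphism (P ^A ×ₐ act) P evMap
        isExponential     : IsExponential (Act monoid) (actProducts monoid)
                              P act (P ^A) (mkHom evMap ev-isHomomorphism)

{-# OPTIONS --safe #-}
-- Everything rests on [a,u] v = [av, uv].  It gives [x,u+][a,v] = [a,uv] for
-- all a, u and v, so the substitution [x,u+] turns into right multiplication by
-- u as soon as its variable is filled.  Exponentials in Act_G, on the other
-- hand, exist for every monoid: B^A is hom(G × A, B), by the Yoneda argument
-- for one-object presheaves.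
module Submission where

open import Defs
open import Algebra.Bundles using (Monoid)
open import Data.Product using (_×_; _,_)
open import Data.Unit.Polymorphic using (⊤)
open import Function.Bundles using (Inverse; Bijection)
open import Function.Properties.Inverse using (Inverse⇒Bijection)
open import Level using (Level)
open import Relation.Binary.Bundles using (Setoid)
import Relation.Binary.Reasoning.Setoid as SetoidReasoning

-- Cartesian closure of the right acts of an arbitrary monoid.

module _ {ℓ : Level} {G : Monoid ℓ ℓ} where
  private module G = Monoid G

  Hom-setoid : RightAct G → RightAct G → Setoid ℓ ℓ
  Hom-setoid S T = record
    { isEquivalence = Category.isEquiv (Act G) {S} {T} }

  ⊤-act : RightAct G
  ⊤-act = record
    { setoid     = record
        { Carrier       = ⊤
        ; _≈_           = λ _ _ → ⊤
        ; isEquivalence = _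
        }
    ; _·_        = _
    ; ·-cong     = _
    ; ·-assoc    = _
    ; ·-identity = _
    }

  regular : RightAct G
  regular = record
    { setoid     = G.setoid
    ; _·_        = G._∙_
    ; ·-cong     = G.∙-cong
    ; ·-assoc    = G.assoc
    ; ·-identity = G.identityʳ
    }

  module _ (B A : RightAct G) where
    private
      module A = RightAct A
      module B = RightAct B

    -- Left multiplication by `u` is an endomorphism of the regular act. Precomposing with it
    -- reverses the order of composition, so the resulting action is a right one.
    translate : Hom (regular ×ₐ A) B → G.Carrier → Hom (regular ×ₐ A) B
    translate φ u = mkHom (λ (v , a) → φ.⟦_⟧ (u G.∙ v , a)) record
      { cong        = λ (p , q) → φ.cong (G.∙-cong G.refl p , q)
      ; equivariant = λ (v , a) w → B.trans
          (φ.cong (G.sym (G.assoc u v w) , A.refl))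
          (φ.equivariant (u G.∙ v , a) w)
      }
      where module φ = Hom φ

    exponentialAct : RightAct G
    exponentialAct = record
      { setoid     = Hom-setoid (regular ×ₐ A) B
      ; _·_        = translate
      ; ·-cong     = λ {φ} {ψ} {u} {v} p q (w , a) → B.trans
          (Hom.cong φ (G.∙-cong q G.refl , A.refl)) (p (v G.∙ w , a))
      ; ·-assoc    = λ φ u v (w , a) →
          Hom.cong φ (G.sym (G.assoc u v w) , A.refl)
      ; ·-identity = λ φ (w , a) → Hom.cong φ (G.identityˡ w , A.refl)
      }

    evaluate : Hom (exponentialAct ×ₐ A) B
    evaluate = mkHom (λ (φ , a) → Hom.⟦_⟧ φ (G.ε , a)) record
      { cong        = λ {(φ , a)} {(ψ , b)} (p , q) →
          B.trans (Hom.cong φ (G.refl , q)) (p (G.ε , b))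
      -- Both sides are the value of `φ` at `(u , a · u)`, reached once as `u ∙ ε` and once as
      -- `ε ∙ u`.
      ; equivariant = λ (φ , a) u → B.trans
          (Hom.cong φ
            (G.trans (G.identityʳ u) (G.sym (G.identityˡ u)) , A.refl))
          (Hom.equivariant φ (G.ε , a) u)
      }

    module _ (T : RightAct G) where
      private module T = RightAct T

      curry : Hom (T ×ₐ A) B → Hom T exponentialAct
      curry f = mkHom
        (λ t → mkHom (λ (u , a) → f.⟦_⟧ (t T.· u , a)) record
          { cong        = λ (p , q) → f.cong (T.·-cong T.refl p , q)
          ; equivariant = λ (u , a) v → B.trans
              (f.cong (T.sym (T.·-assoc t u v) , A.refl))
              (f.equivariant (t T.· u , a) v)
          })
        record
          { cong        = λ p (u , a) → f.cong (T.·-cong p G.refl , A.refl)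
          ; equivariant = λ t u (v , a) → f.cong (T.·-assoc t u v , A.refl)
          }
        where module f = Hom f

    evaluate-isExponential :
      IsExponential (Act G) (actProducts G) B A exponentialAct evaluate
    evaluate-isExponential T f =
        curry T f
      , (λ (t , a) → Hom.cong f (T.·-identity t , A.refl))
      -- Uniqueness is Yoneda: the value of `g t` at `(u , a)` is that of its translate by `u` at
      -- `(ε , a)`, and this translate is `g (t · u)`.
      , λ {g} g-lifts-f t (u , a) → begin
          Hom.⟦_⟧ f (t T.· u , a)                     ≈⟨ g-lifts-f (t T.· u , a) ⟨
          Hom.⟦_⟧ (Hom.⟦_⟧ g (t T.· u)) (G.ε , a)     ≈⟨ Hom.equivariant g t u (G.ε , a) ⟩
          Hom.⟦_⟧ (Hom.⟦_⟧ g t) (u G.∙ G.ε , a)       ≈⟨ Hom.cong (Hom.⟦_⟧ g t) (G.identityʳ u , A.refl) ⟩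
          Hom.⟦_⟧ (Hom.⟦_⟧ g t) (u , a)               ∎
      where
      module T = RightAct T
      open SetoidReasoning B.setoid

Act-cartesianClosed : ∀ {ℓ} (G : Monoid ℓ ℓ) → CartesianClosed (Act G)
Act-cartesianClosed G = record
  { terminal     = record
      { ⊤        = ⊤-act
      ; !        = mkHom _ record { cong = _ ; equivariant = _ }
      ; !-unique = _
      }
  ; products     = actProducts G
  ; exponentials = λ B A → record
      { object        = exponentialAct B A
      ; ev            = evaluate B A
      ; isExponential = evaluate-isExponential B A
      }
  }

-- The genoid exponential and the bijection `Λ`.

module _ {ℓ : Level} (𝔾 : Genoid ℓ) where
  open Genoid 𝔾
  private
    module G = Monoid monoid
    module A = RightAct act

  +-[] : ∀ u a v → (u G.∙ +) G.∙ [ a , v ] G.≈ u G.∙ v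
  +-[] u a v = G.trans (G.assoc u + _) (G.∙-cong G.refl (G2 a v))

  lift-[] : ∀ u a v → [ x , u G.∙ + ] G.∙ [ a , v ] G.≈ [ a , u G.∙ v ]
  lift-[] u a v = G.trans ([]-∙ 𝔾 _ _ _) ([]-cong (G1 a v) (+-[] u a v))

  module _ (P : RightAct monoid) where
    private
      module P = RightAct P
      module Pᴬ = RightAct ((𝔾 ^A) P)

    -- Unfolds the twisted action under a bracket, both for the equivariance of `ev` and for
    -- `Λ (Λ′ g) ≈ g`.
    lift-· : ∀ p u a v →
             p Pᴬ.· u P.· [ a , v ] P.≈ p P.· [ a , u G.∙ v ]
    lift-· p u a v =
      P.trans (P.·-assoc p _ _) (P.·-cong P.refl (lift-[] u a v))

    evMap-isHomomorphism : IsHomomorphism ((𝔾 ^A) P ×ₐ act) P (evMap 𝔾 P)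
    evMap-isHomomorphism = record
      { cong        = λ (p , q) → P.·-cong p ([]-cong q G.refl)
      ; equivariant = λ (p , a) u → begin
          p Pᴬ.· u P.· [ a A.· u , G.ε ]  ≈⟨ lift-· p u _ G.ε ⟩
          -- Since `[a,ε] u = [au,εu]`, the product `u ε` must become `ε u` before `u` can leave the
          -- bracket on the right.
          p P.· [ a A.· u , u G.∙ G.ε ]   ≈⟨ P.·-cong P.refl ([]-cong A.refl
                                               (G.trans (G.identityʳ u) (G.sym (G.identityˡ u)))) ⟩
          p P.· [ a A.· u , G.ε G.∙ u ]   ≈⟨ P.·-cong P.refl ([]-∙ 𝔾 a G.ε u) ⟨
          p P.· ([ a , G.ε ] G.∙ u)       ≈⟨ P.·-assoc p _ u ⟨
          p P.· [ a , G.ε ] P.· u         ∎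
      }
      where open SetoidReasoning P.setoid

    module _ (T : RightAct monoid) where
      private module T = RightAct T

      ΛMap-isHomomorphism :
        ∀ f → IsHomomorphism T ((𝔾 ^A) P) (ΛMap 𝔾 P T f)
      ΛMap-isHomomorphism f = record
        { cong        = λ p → f.cong (T.·-cong p G.refl , A.refl)
        -- The element `[x,u+]`, through which `u` acts on `P ^A`, sends `(t+, x)` to `(tu+, x)` by
        -- `G2` and `G1`.
        ; equivariant = λ t u → P.trans
            (f.cong
              ( T.trans (T.·-assoc t u +) (T.trans
                  (T.·-cong T.refl (G.sym (G2 x (u G.∙ +))))
                  (T.sym (T.·-assoc t + _)))
              , A.sym (G1 x (u G.∙ +))))
            (f.equivariant (t T.· + , x) _)
        }
        where module f = Hom f

      Λ′Map-isHomomorphism :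
        ∀ g → IsHomomorphism (T ×ₐ act) P (Λ′Map 𝔾 P T g)
      -- `Λ′Map g` unfolds to `ev` after `g × id`, so the property is inherited from composition in
      -- the category.
      Λ′Map-isHomomorphism g = Hom.isHomomorphism
        (ev ∘ ⟨ g ∘ π₁ {T} {act} , π₂ {T} {act} ⟩)
        where
        open Category (Act monoid)
        open BinaryProducts (actProducts monoid)
        ev = mkHom (evMap 𝔾 P) evMap-isHomomorphism

      Λ-inverse :
        Inverse (Hom-setoid (T ×ₐ act) P) (Hom-setoid T ((𝔾 ^A) P))
      Λ-inverse = record
        { to        = to
        ; from      = from
        ; to-cong   = λ p t → p (t T.· + , x)
        ; from-cong = λ p (t , a) → P.·-cong (p t) G.refl
        ; inverse   =
              (λ {g} p t → P.trans (p (t T.· + , x)) (to-from g t))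
            , (λ {f} p (t , a) → P.trans (P.·-cong (p t) G.refl) (from-to f (t , a)))
        }
        where
        to : Hom (T ×ₐ act) P → Hom T ((𝔾 ^A) P)
        to f = mkHom (ΛMap 𝔾 P T f) (ΛMap-isHomomorphism f)
        from : Hom T ((𝔾 ^A) P) → Hom (T ×ₐ act) P
        from g = mkHom (Λ′Map 𝔾 P T g) (Λ′Map-isHomomorphism g)
        to-from : ∀ g → to (from g) ≈ₕ g
        to-from g t = begin
          g.⟦_⟧ (t T.· +) P.· [ x , G.ε ]    ≈⟨ P.·-cong (g.equivariant t +) G.refl ⟩
          g.⟦_⟧ t Pᴬ.· + P.· [ x , G.ε ]     ≈⟨ lift-· (g.⟦_⟧ t) + x G.ε ⟩
          -- After the exchange of `+ ε` for `ε +`, the bracket is the element through which `ε`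
          -- acts on `P ^A`, and the unit law applies.
          g.⟦_⟧ t P.· [ x , + G.∙ G.ε ]      ≈⟨ P.·-cong P.refl ([]-cong A.refl
                                                 (G.trans (G.identityʳ +) (G.sym (G.identityˡ +)))) ⟩
          g.⟦_⟧ t Pᴬ.· G.ε                   ≈⟨ Pᴬ.·-identity (g.⟦_⟧ t) ⟩
          g.⟦_⟧ t                            ∎
          where
          module g = Hom g
          open SetoidReasoning P.setoid
        from-to : ∀ f → from (to f) ≈ₕ f
        -- The pair `(t+, x)` is generic: `[a,ε]` sends it to `(t, a)` by `G2` and `G1`, so
        -- equivariance recovers `f` from its values on such pairs.
        from-to f (t , a) = P.trans
          (P.sym (f.equivariant (t T.· + , x) [ a , G.ε ]))
          (f.cong
            ( T.trans (T.·-assoc t + _) (T.trans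
                (T.·-cong T.refl (G2 a G.ε)) (T.·-identity t))
            , G1 a G.ε))
          where module f = Hom f

      Λ-isBijectionWithInverseΛ′ : ΛIsBijectionWithInverseΛ′ 𝔾 P T
      Λ-isBijectionWithInverseΛ′ = record
        { Λ-isHomomorphism  = ΛMap-isHomomorphism
        ; Λ′-isHomomorphism = Λ′Map-isHomomorphism
        ; isBijection       = Bijection.isBijection (Inverse⇒Bijection Λ-inverse)
        ; isInverse         = Inverse.isInverse Λ-inverse
        }

    ev-isExponential : EvIsExponential 𝔾 P
    ev-isExponential = record
      { ev-isHomomorphism = evMap-isHomomorphism
      -- The triangle for `g` says exactly `Λ′ g ≈ f`. Existence is thus `Λ′ (Λ f) ≈ f`, and
      -- uniqueness comes from `Λ` undoing `Λ′`.
      ; isExponential     = λ T f → let module Λ = Inverse (Λ-inverse T) in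
            Λ.to f
          , Λ.strictlyInverseʳ f
          , λ {g} Λ′g≈f → Λ.inverseˡ {g} {f} λ s → P.sym (Λ′g≈f s)
      }

mainTheorem1 : ∀ {ℓ} (𝔾 : Genoid ℓ) → let open Genoid 𝔾 in
    ((P : RightAct monoid) →
    ((T : RightAct monoid) → ΛIsBijectionWithInverseΛ′ 𝔾 P T)
    × EvIsExponential 𝔾 P)
    × CartesianClosed (Act monoid)
    × ΛIsBijectionWithInverseΛ′ 𝔾 act act
mainTheorem1 𝔾 =
    (λ P → Λ-isBijectionWithInverseΛ′ 𝔾 P , ev-isExponential 𝔾 P)
  , Act-cartesianClosed monoid
  , Λ-isBijectionWithInverseΛ′ 𝔾 act act
  where open Genoid 𝔾
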